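{- For all non-negative integers $n$ and $p$, $$\begin{aligned}\sum_{k=1}^n\frac{k}{2^{2k}}\binom{2(k+p)}{k+p}\binom{k+p}{k}\left(O_{k+p}-O_p\right)&=\frac{n}{2^{2n}}\binom{2(p+1)}{p+1}^{ -1}\binom{2p}{p}\binom{2(n+p+1)}{n+p+1}\binom{n+p+1}{n}\left(O_{n+p+1}-O_{p+1}\right)\\&\quad-\frac{1}{2^{2n-2}}\binom{2(p+2)}{p+2}^{ -1}\binom{2p}{p}\binom{2(n+p+1)}{n+p+1}\binom{n+p+1}{n-1}\left(O_{n+p+1}-O_{p+2}\right).\end{aligned}$$ In particular, $\sum_{k=1}^n\frac{k}{2^{2k}}\binom{2k}{k}O_k=\frac{n(n+1)}{2^{2n+1}}\binom{2(n+1)}{n+1}(O_{n+1}-1)-\frac{n(n+1)}{3\cdot2^{2n}}\binom{2(n+1)}{n+1}\left(O_{n+1}-\frac43\right)$.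
   Context: The odd harmonic numbers are $O_n=\sum_{k=1}^n\frac{1}{2k-1}$, $O_0=0$. Binomial coefficients $\binom{a}{ -1}$ are $0$. -}

module Defs where

open import Data.Integer using (ℤ; +_; -[1+_])
open import Data.Nat as ℕ using (ℕ; zero; suc; NonZero; _≤_)
open import Data.Nat.Combinatorics using (_C_; nCk≡n!/k![n-k]!; k![n∸k]!∣n!)
open import Data.Nat.Divisibility using (∣⇒≤)
open import Data.Nat.DivMod using (m≥n⇒m/n>0)
open import Data.Nat.Properties using (m^n≢0; m≤m+n; _!≢0; _!*_!≢0)
open import Data.Rational using (ℚ; 0ℚ; _+_; _/_)
open import Relation.Binary.PropositionalEquality using (sym; subst)

∑₁ : ℕ → (ℕ → ℚ) → ℚ
∑₁ zero    f = 0ℚ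
∑₁ (suc n) f = ∑₁ n f + f (suc n)

-- The term of index k = suc n is 1 / (2k - 1) = 1 / (1 + 2n).
O : ℕ → ℚ
O zero    = 0ℚ
O (suc n) = O n + + 1 / suc (2 ℕ.* n)

-- The lower index is an integer so that a negative one, such as n - 1 at
-- n = 0, gives 0 (truncated subtraction would give 1 there).
binom : ℕ → ℤ → ℚ
binom a (+ k)    = + (a C k) / 1
binom a -[1+ _ ] = 0ℚ

k≤n⇒nCk≢0 : ∀ {n k} → k ≤ n → NonZero (n C k)
k≤n⇒nCk≢0 {n} {k} k≤n =
  subst NonZero (sym (nCk≡n!/k![n-k]! k≤n))
    (ℕ.>-nonZero (m≥n⇒m/n>0 (∣⇒≤ {{n !≢0}} (k![n∸k]!∣n! k≤n))))
  where instance _ = k !* (n ℕ.∸ k) !≢0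

-- The reciprocal of the central binomial coefficient binom (2 * m) (+ m).
centralBinom⁻¹ : ℕ → ℚ
centralBinom⁻¹ m = + 1 / ((2 ℕ.* m) C m)
  where instance _ = k≤n⇒nCk≢0 (m≤m+n m (1 ℕ.* m))

infix 8 1/2^_

-- 1 / 2 ^ z for an integer exponent z; needed since 2n - 2 is negative at n = 0.
1/2^_ : ℤ → ℚ
1/2^ (+ n)    = + 1 / (2 ℕ.^ n)
  where instance _ = m^n≢0 2 n
1/2^ -[1+ n ] = + (2 ℕ.^ suc n) / 1

{-# OPTIONS --safe #-}

-- Put s = n + p and T(n) = 4⁻ⁿ C(2s,s) C(s,n).  The ratios of consecutive
-- (central) binomial coefficients turn the right-hand side into
--   n T(n) (2s+1)/(2p+1) ((O_{s+1} - O_{p+1}) - 2/(2p+3) (O_{s+1} - O_{p+2})),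
-- and give (n+1) T(n+1) = (2s+1)/2 T(n).  So consecutive values of this closed
-- form share the factor T(n), and their difference is the (n+1)-st summand by
-- a rational identity in n, p and the harmonic numbers.  The second formula is
-- the case p = 0.
module Submission where

open import Defs
open import Data.Integer as ℤ using (+_)
import Data.Integer.Properties as ℤ
open import Data.Nat as ℕ using (ℕ; zero; suc; NonZero; _!)
open import Data.Nat.Combinatorics using (_C_; nCk≡n!/k![n-k]!; k![n∸k]!∣n!; nCn≡1)
open import Data.Nat.DivMod using (m/n*n≡m)
import Data.Nat.Properties as ℕ
open import Data.Nat.Solver using () renaming (module +-*-Solver to ℕSolver)
open import Data.Product using (_×_; _,_)
open import Data.Rational using (ℚ; 0ℚ; 1ℚ; _+_; _-_; _*_; _/_; fromℚᵘ)
open import Data.Rational.Properties using (toℚᵘ-injective; toℚᵘ-fromℚᵘ; toℚᵘ-homo-+; toℚᵘ-homo-*; fromℚᵘ-cong; /-cong; *-identityʳ; *-assoc; *-zeroʳ)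
open import Data.Rational.Solver using (module +-*-Solver)
import Data.Rational.Unnormalised as ℚᵘ
import Data.Rational.Unnormalised.Properties as ℚᵘ
open import Relation.Binary.PropositionalEquality using (_≡_; refl; sym; trans; cong; cong₂; subst; module ≡-Reasoning)

open ≡-Reasoning

-- Ratios of consecutive binomial coefficients over ℕ.

-- Writing the upper index as `a + b` keeps truncated subtraction out of all later ratios.
nCk*k!*[n-k]!≡n! : ∀ a b → ((a ℕ.+ b) C a) ℕ.* (a ! ℕ.* b !) ≡ (a ℕ.+ b) !
nCk*k!*[n-k]!≡n! a b = subst (λ d → ((a ℕ.+ b) C a) ℕ.* (a ! ℕ.* d !) ≡ (a ℕ.+ b) !) (ℕ.m+n∸m≡n a b) (begin
  ((a ℕ.+ b) C a) ℕ.* d                 ≡⟨ cong (ℕ._* d) (nCk≡n!/k![n-k]! (ℕ.m≤m+n a b)) ⟩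
  ((a ℕ.+ b) ! ℕ./ d) ℕ.* d             ≡⟨ m/n*n≡m (k![n∸k]!∣n! (ℕ.m≤m+n a b)) ⟩
  (a ℕ.+ b) !                           ∎)
  where
  d = a ! ℕ.* (a ℕ.+ b ℕ.∸ a) !
  instance _ = a ℕ.!* (a ℕ.+ b ℕ.∸ a) !≢0

-- Multiplied by `a ! * b !`, both sides become the factorial of `a + b + 1`; the nonzero factor is
-- then cancelled.
[1+b]*C[a,1+b] : ∀ a b → suc b ℕ.* (suc (a ℕ.+ b) C a) ≡ suc (a ℕ.+ b) ℕ.* ((a ℕ.+ b) C a)
[1+b]*C[a,1+b] a b = ℕ.*-cancelʳ-≡ _ _ (a ! ℕ.* b !) (begin
  suc b ℕ.* x ℕ.* (a ! ℕ.* b !)                ≡⟨ ℕSolver.solve 4 (λ m x f g → m :* x :* (f :* g) := x :* (f :* (m :* g))) refl (suc b) x (a !) (b !) ⟩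
  x ℕ.* (a ! ℕ.* suc b !)                      ≡⟨ subst (λ s → (s C a) ℕ.* (a ! ℕ.* suc b !) ≡ s !) (ℕ.+-suc a b) (nCk*k!*[n-k]!≡n! a (suc b)) ⟩
  suc (a ℕ.+ b) ℕ.* (a ℕ.+ b) !                ≡⟨ cong (suc (a ℕ.+ b) ℕ.*_) (nCk*k!*[n-k]!≡n! a b) ⟨
  suc (a ℕ.+ b) ℕ.* (y ℕ.* (a ! ℕ.* b !))      ≡⟨ ℕ.*-assoc (suc (a ℕ.+ b)) y _ ⟨
  suc (a ℕ.+ b) ℕ.* y ℕ.* (a ! ℕ.* b !)        ∎)
  where
  open ℕSolver using (_:*_; _:=_)
  x = suc (a ℕ.+ b) C a
  y = (a ℕ.+ b) C a
  instance _ = a ℕ.!* b !≢0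

[1+a]*C[1+a,b] : ∀ a b → suc a ℕ.* (suc (a ℕ.+ b) C suc a) ≡ suc (a ℕ.+ b) ℕ.* ((a ℕ.+ b) C a)
[1+a]*C[1+a,b] a b = ℕ.*-cancelʳ-≡ _ _ (a ! ℕ.* b !) (begin
  suc a ℕ.* x ℕ.* (a ! ℕ.* b !)                ≡⟨ ℕSolver.solve 4 (λ m x f g → m :* x :* (f :* g) := x :* ((m :* f) :* g)) refl (suc a) x (a !) (b !) ⟩
  x ℕ.* (suc a ! ℕ.* b !)                      ≡⟨ nCk*k!*[n-k]!≡n! (suc a) b ⟩
  suc (a ℕ.+ b) ℕ.* (a ℕ.+ b) !                ≡⟨ cong (suc (a ℕ.+ b) ℕ.*_) (nCk*k!*[n-k]!≡n! a b) ⟨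
  suc (a ℕ.+ b) ℕ.* (y ℕ.* (a ! ℕ.* b !))      ≡⟨ ℕ.*-assoc (suc (a ℕ.+ b)) y _ ⟨
  suc (a ℕ.+ b) ℕ.* y ℕ.* (a ! ℕ.* b !)        ∎)
  where
  open ℕSolver using (_:*_; _:=_)
  x = suc (a ℕ.+ b) C suc a
  y = (a ℕ.+ b) C a
  instance _ = a ℕ.!* b !≢0

-- The upper index drops from 2m+2 to 2m in two steps, the first lowering the complement and the
-- second the lower index. The first contributes 2m+2, whose factor m+1 is consumed by the second.
centralBinom-suc : ∀ m → suc m ℕ.* ((2 ℕ.* suc m) C suc m) ≡ 2 ℕ.* (suc (2 ℕ.* m) ℕ.* ((2 ℕ.* m) C m))
centralBinom-suc m = begin
  suc m ℕ.* ((2 ℕ.* suc m) C suc m)                    ≡⟨ cong (λ r → suc m ℕ.* (r C suc m)) (solve 1 (λ m → con 2 :* (con 1 :+ m) := con 1 :+ (con 1 :+ m :+ m)) refl m) ⟩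
  suc m ℕ.* (suc (suc m ℕ.+ m) C suc m)                ≡⟨ [1+b]*C[a,1+b] (suc m) m ⟩
  suc (suc m ℕ.+ m) ℕ.* ((suc m ℕ.+ m) C suc m)        ≡⟨ solve 2 (λ m x → (con 1 :+ (con 1 :+ m :+ m)) :* x := con 2 :* ((con 1 :+ m) :* x)) refl m (suc (m ℕ.+ m) C suc m) ⟩
  2 ℕ.* (suc m ℕ.* (suc (m ℕ.+ m) C suc m))            ≡⟨ cong (2 ℕ.*_) ([1+a]*C[1+a,b] m m) ⟩
  2 ℕ.* (suc (m ℕ.+ m) ℕ.* ((m ℕ.+ m) C m))            ≡⟨ cong (λ r → 2 ℕ.* (suc (m ℕ.+ r) ℕ.* ((m ℕ.+ r) C m))) (sym (ℕ.+-identityʳ m)) ⟩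
  2 ℕ.* (suc (2 ℕ.* m) ℕ.* ((2 ℕ.* m) C m))            ∎
  where open ℕSolver

-- Arithmetic of naturals and unit fractions in ℚ.

-- `_/_` normalises by a gcd that is stuck on variables, so sums and products of fractions are
-- computed unnormalised and carried over through the injective homomorphism `toℚᵘ`.
fromℚᵘ-homo-+ : ∀ x y → fromℚᵘ (x ℚᵘ.+ y) ≡ fromℚᵘ x + fromℚᵘ y
fromℚᵘ-homo-+ x y = toℚᵘ-injective (ℚᵘ.≃-trans (toℚᵘ-fromℚᵘ (x ℚᵘ.+ y)) (ℚᵘ.≃-sym
  (ℚᵘ.≃-trans (toℚᵘ-homo-+ (fromℚᵘ x) (fromℚᵘ y)) (ℚᵘ.+-cong (toℚᵘ-fromℚᵘ x) (toℚᵘ-fromℚᵘ y)))))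

fromℚᵘ-homo-* : ∀ x y → fromℚᵘ (x ℚᵘ.* y) ≡ fromℚᵘ x * fromℚᵘ y
fromℚᵘ-homo-* x y = toℚᵘ-injective (ℚᵘ.≃-trans (toℚᵘ-fromℚᵘ (x ℚᵘ.* y)) (ℚᵘ.≃-sym
  (ℚᵘ.≃-trans (toℚᵘ-homo-* (fromℚᵘ x) (fromℚᵘ y)) (ℚᵘ.*-cong (toℚᵘ-fromℚᵘ x) (toℚᵘ-fromℚᵘ y)))))

ι : ℕ → ℚ
ι n = + n / 1

ι-homo-+ : ∀ m n → ι (m ℕ.+ n) ≡ ι m + ι n
ι-homo-+ m n = trans
  -- Unnormalised addition produces the numerator `m * 1 + n * 1`.
  (cong (_/ 1) (cong₂ ℤ._+_ (sym (ℤ.*-identityʳ (+ m))) (sym (ℤ.*-identityʳ (+ n)))))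
  (fromℚᵘ-homo-+ (ℚᵘ.mkℚᵘ (+ m) 0) (ℚᵘ.mkℚᵘ (+ n) 0))

ι-homo-* : ∀ m n → ι (m ℕ.* n) ≡ ι m * ι n
ι-homo-* m n = trans (cong (_/ 1) (ℤ.pos-* m n)) (fromℚᵘ-homo-* (ℚᵘ.mkℚᵘ (+ m) 0) (ℚᵘ.mkℚᵘ (+ n) 0))

n/d≡n*1/d : ∀ n d .{{_ : NonZero d}} → + n / d ≡ ι n * (+ 1 / d)
n/d≡n*1/d n (suc d) = trans
  (/-cong (sym (ℤ.*-identityʳ (+ n))) (sym (ℕ.*-identityˡ (suc d))))
  (fromℚᵘ-homo-* (ℚᵘ.mkℚᵘ (+ n) 0) (ℚᵘ.mkℚᵘ (+ 1) d))

n*1/n≡1 : ∀ n .{{_ : NonZero n}} → ι n * (+ 1 / n) ≡ 1ℚ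
n*1/n≡1 (suc n) = trans (sym (n/d≡n*1/d (suc n) (suc n)))
  (fromℚᵘ-cong {ℚᵘ.mkℚᵘ (+ suc n) n} {ℚᵘ.mkℚᵘ (+ 1) 0} (ℚᵘ.*≡* (ℤ.*-comm (+ suc n) (+ 1))))

1/[m*n]≡1/m*1/n : ∀ m n .{{_ : NonZero m}} .{{_ : NonZero n}} .{{_ : NonZero (m ℕ.* n)}} →
  + 1 / (m ℕ.* n) ≡ (+ 1 / m) * (+ 1 / n)
1/[m*n]≡1/m*1/n (suc m) (suc n) = fromℚᵘ-homo-* (ℚᵘ.mkℚᵘ (+ 1) m) (ℚᵘ.mkℚᵘ (+ 1) n)

ι-cross : ∀ a b c d → a ℕ.* b ≡ c ℕ.* d → ι a * ι b ≡ ι c * ι d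
ι-cross a b c d eq = trans (sym (ι-homo-* a b)) (trans (cong ι eq) (ι-homo-* c d))

-- Ratios of powers of 2 and binomial coefficients over ℚ.

central : ℕ → ℚ
central m = binom (2 ℕ.* m) (+ m)

odd : ℕ → ℚ
odd m = ι (suc (2 ℕ.* m))

odd⁻¹ : ℕ → ℚ
odd⁻¹ m = + 1 / suc (2 ℕ.* m)

½ : ℚ
½ = + 1 / 2

odd-+ : ∀ n p → odd (n ℕ.+ p) ≡ ι 2 * ι n + odd p
odd-+ n p = begin
  odd (n ℕ.+ p)                     ≡⟨ cong ι (ℕSolver.solve 2 (λ n p → con 1 :+ con 2 :* (n :+ p) := con 2 :* n :+ (con 1 :+ con 2 :* p)) refl n p) ⟩
  ι (2 ℕ.* n ℕ.+ suc (2 ℕ.* p))     ≡⟨ ι-homo-+ (2 ℕ.* n) (suc (2 ℕ.* p)) ⟩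
  ι (2 ℕ.* n) + odd p               ≡⟨ cong (_+ odd p) (ι-homo-* 2 n) ⟩
  ι 2 * ι n + odd p                 ∎
  where open ℕSolver using (con; _:+_; _:*_; _:=_)

1/2^-suc : ∀ m → 1/2^ (+ suc m) ≡ ½ * 1/2^ (+ m)
1/2^-suc m = 1/[m*n]≡1/m*1/n 2 (2 ℕ.^ m)
  where
  instance
    _ = ℕ.m^n≢0 2 m
    _ = ℕ.m^n≢0 2 (suc m)

1/2^-2*suc : ∀ n → 1/2^ (+ (2 ℕ.* suc n)) ≡ ½ * (½ * 1/2^ (+ (2 ℕ.* n)))
1/2^-2*suc n = begin
  1/2^ (+ (2 ℕ.* suc n))            ≡⟨ cong (λ m → 1/2^ (+ m)) (ℕ.*-suc 2 n) ⟩
  1/2^ (+ suc (suc (2 ℕ.* n)))      ≡⟨ 1/2^-suc (suc (2 ℕ.* n)) ⟩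
  ½ * 1/2^ (+ suc (2 ℕ.* n))        ≡⟨ cong (½ *_) (1/2^-suc (2 ℕ.* n)) ⟩
  ½ * (½ * 1/2^ (+ (2 ℕ.* n)))      ∎

1/2^[2n-2] : ∀ n → 1/2^ (+ (2 ℕ.* n) ℤ.- + 2) ≡ ι 4 * 1/2^ (+ (2 ℕ.* n))
-- The exponent is -2 here, and both sides evaluate to 4.
1/2^[2n-2] zero    = refl
1/2^[2n-2] (suc n) = begin
  1/2^ (+ (2 ℕ.* suc n) ℤ.- + 2)          ≡⟨ cong (λ m → 1/2^ (+ m ℤ.- + 2)) (ℕ.*-suc 2 n) ⟩
  h                                       ≡⟨ solve 1 (λ h → h := con (ι 4) :* (con ½ :* (con ½ :* h))) refl h ⟩
  ι 4 * (½ * (½ * h))                     ≡⟨ cong (ι 4 *_) (1/2^-2*suc n) ⟨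
  ι 4 * 1/2^ (+ (2 ℕ.* suc n))            ∎
  where
  open +-*-Solver
  h = 1/2^ (+ (2 ℕ.* n))

central-suc : ∀ m → ι (suc m) * central (suc m) ≡ ι 2 * (odd m * central m)
central-suc m = begin
  ι (suc m) * central (suc m)                              ≡⟨ ι-cross (suc m) ((2 ℕ.* suc m) C suc m) 2 (suc (2 ℕ.* m) ℕ.* ((2 ℕ.* m) C m)) (centralBinom-suc m) ⟩
  ι 2 * ι (suc (2 ℕ.* m) ℕ.* ((2 ℕ.* m) C m))              ≡⟨ cong (ι 2 *_) (ι-homo-* (suc (2 ℕ.* m)) ((2 ℕ.* m) C m)) ⟩
  ι 2 * (odd m * central m)                                ∎

central*central⁻¹≡1 : ∀ m → central m * centralBinom⁻¹ m ≡ 1ℚ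
central*central⁻¹≡1 m = n*1/n≡1 ((2 ℕ.* m) C m)
  where instance _ = k≤n⇒nCk≢0 (ℕ.m≤m+n m (1 ℕ.* m))

centralBinom⁻¹-suc : ∀ m → centralBinom⁻¹ (suc m) ≡ ½ * (ι (suc m) * odd⁻¹ m) * centralBinom⁻¹ m
centralBinom⁻¹-suc m = begin
  -- The two inserted units are expanded to `z * u` and `c * i`, which brings in the product `z * c`
  -- that `central-suc` exchanges for `P * c′`.
  i′                              ≡⟨ solve 1 (λ i′ → i′ := i′ :* con 1ℚ :* con 1ℚ) refl i′ ⟩
  i′ * 1ℚ * 1ℚ                    ≡⟨ cong₂ (λ x y → i′ * x * y) (n*1/n≡1 (suc (2 ℕ.* m))) (central*central⁻¹≡1 m) ⟨
  i′ * (z * u) * (c * i)          ≡⟨ solve 5 (λ i′ z u c i → i′ :* (z :* u) :* (c :* i) := con ½ :* i′ :* u :* i :* (con (ι 2) :* (z :* c))) refl i′ z u c i ⟩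
  ½ * i′ * u * i * (ι 2 * (z * c)) ≡⟨ cong (½ * i′ * u * i *_) (central-suc m) ⟨
  ½ * i′ * u * i * (P * c′)       ≡⟨ solve 5 (λ i′ u i P c′ → con ½ :* i′ :* u :* i :* (P :* c′) := con ½ :* (P :* u) :* i :* (c′ :* i′)) refl i′ u i P c′ ⟩
  ½ * (P * u) * i * (c′ * i′)     ≡⟨ cong (½ * (P * u) * i *_) (central*central⁻¹≡1 (suc m)) ⟩
  ½ * (P * u) * i * 1ℚ            ≡⟨ *-identityʳ _ ⟩
  ½ * (P * u) * i                 ∎
  where
  open +-*-Solver
  i = centralBinom⁻¹ m
  i′ = centralBinom⁻¹ (suc m)
  c = central m
  c′ = central (suc m)
  z = odd m
  u = odd⁻¹ m
  P = ι (suc m)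

centralBinom⁻¹[1+p]*central : ∀ p → centralBinom⁻¹ (suc p) * central p ≡ ½ * (ι (suc p) * odd⁻¹ p)
centralBinom⁻¹[1+p]*central p = begin
  centralBinom⁻¹ (suc p) * c  ≡⟨ cong (_* c) (centralBinom⁻¹-suc p) ⟩
  ½ * x * i * c               ≡⟨ solve 3 (λ x i c → con ½ :* x :* i :* c := con ½ :* x :* (c :* i)) refl x i c ⟩
  ½ * x * (c * i)             ≡⟨ cong (½ * x *_) (central*central⁻¹≡1 p) ⟩
  ½ * x * 1ℚ                  ≡⟨ *-identityʳ _ ⟩
  ½ * x                       ∎
  where
  open +-*-Solver
  x = ι (suc p) * odd⁻¹ p
  c = central p
  i = centralBinom⁻¹ p

centralBinom⁻¹[2+p]*central : ∀ p → centralBinom⁻¹ (suc (suc p)) * central p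
  ≡ ½ * (ι (suc (suc p)) * odd⁻¹ (suc p)) * (½ * (ι (suc p) * odd⁻¹ p))
centralBinom⁻¹[2+p]*central p = begin
  centralBinom⁻¹ (suc (suc p)) * c  ≡⟨ cong (_* c) (centralBinom⁻¹-suc (suc p)) ⟩
  y * i * c                         ≡⟨ *-assoc y i c ⟩
  y * (i * c)                       ≡⟨ cong (y *_) (centralBinom⁻¹[1+p]*central p) ⟩
  y * (½ * (ι (suc p) * odd⁻¹ p))   ∎
  where
  y = ½ * (ι (suc (suc p)) * odd⁻¹ (suc p))
  c = central p
  i = centralBinom⁻¹ (suc p)

binom-sucᵇ : ∀ n p → ι (suc p) * binom (suc (n ℕ.+ p)) (+ n) ≡ ι (suc (n ℕ.+ p)) * binom (n ℕ.+ p) (+ n)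
binom-sucᵇ n p = ι-cross (suc p) (suc (n ℕ.+ p) C n) (suc (n ℕ.+ p)) ((n ℕ.+ p) C n) ([1+b]*C[a,1+b] n p)

binom-sucᵃ : ∀ n p → ι (suc n) * binom (suc (n ℕ.+ p)) (+ suc n) ≡ ι (suc (n ℕ.+ p)) * binom (n ℕ.+ p) (+ n)
binom-sucᵃ n p = ι-cross (suc n) (suc (n ℕ.+ p) C suc n) (suc (n ℕ.+ p)) ((n ℕ.+ p) C n) ([1+a]*C[1+a,b] n p)

-- Neighbouring entries of one row are compared through the entry above them: for positive `n`, both
-- sides are n+p+1 times the same coefficient of row n+p.
binom-pred : ∀ n p → ι (suc (suc p)) * binom (suc (n ℕ.+ p)) (+ n ℤ.- + 1) ≡ ι n * binom (suc (n ℕ.+ p)) (+ n)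
-- The lower index is -1, so the left side vanishes by the convention in `binom`; the right side has
-- the factor 0.
binom-pred zero    p = *-zeroʳ (ι (suc (suc p)))
binom-pred (suc n) p = subst (λ s → ι (suc (suc p)) * binom (suc s) (+ n) ≡ ι (suc n) * binom (suc s) (+ suc n))
  (ℕ.+-suc n p) (trans (binom-sucᵇ n (suc p)) (sym (binom-sucᵃ n (suc p))))

-- The factor n+p+1 released by the binomial ratio is the one that `central-suc` absorbs. `k` and
-- `a` stay general because the lower index is kept in one use and raised in another.
central*binom : ∀ k a n p → ι k * binom (suc (n ℕ.+ p)) a ≡ ι (suc (n ℕ.+ p)) * binom (n ℕ.+ p) (+ n) →
  ι k * (central (suc (n ℕ.+ p)) * binom (suc (n ℕ.+ p)) a)
    ≡ ι 2 * (odd (n ℕ.+ p) * (central (n ℕ.+ p) * binom (n ℕ.+ p) (+ n)))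
central*binom k a n p eq = begin
  K * (c′ * B′)                ≡⟨ solve 3 (λ K c′ B′ → K :* (c′ :* B′) := c′ :* (K :* B′)) refl K c′ B′ ⟩
  c′ * (K * B′)                ≡⟨ cong (c′ *_) eq ⟩
  c′ * (S * B)                 ≡⟨ solve 3 (λ c′ S B → c′ :* (S :* B) := S :* c′ :* B) refl c′ S B ⟩
  S * c′ * B                   ≡⟨ cong (_* B) (central-suc (n ℕ.+ p)) ⟩
  ι 2 * (z * c) * B            ≡⟨ solve 3 (λ z c B → con (ι 2) :* (z :* c) :* B := con (ι 2) :* (z :* (c :* B))) refl z c B ⟩
  ι 2 * (z * (c * B))          ∎
  where
  open +-*-Solver
  K = ι k
  S = ι (suc (n ℕ.+ p))
  B = binom (n ℕ.+ p) (+ n)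
  B′ = binom (suc (n ℕ.+ p)) a
  c = central (n ℕ.+ p)
  c′ = central (suc (n ℕ.+ p))
  z = odd (n ℕ.+ p)

-- The closed form and its telescoping difference.

summand : ℕ → ℕ → ℚ
summand p k = ι k * 1/2^ (+ (2 ℕ.* k)) * central (k ℕ.+ p) * binom (k ℕ.+ p) (+ k) * (O (k ℕ.+ p) - O p)

-- This is T(n), with the two binomials grouped as in `central*binom`.
weight : ℕ → ℕ → ℚ
weight n p = 1/2^ (+ (2 ℕ.* n)) * (central (n ℕ.+ p) * binom (n ℕ.+ p) (+ n))

-- On the right-hand side of the theorem, the coefficient of the second harmonic difference is
-- 2/(2p+3) times that of the first.
harmonicPart : ℕ → ℕ → ℚ
harmonicPart n p = (O (suc (n ℕ.+ p)) - O (suc p)) - ι 2 * odd⁻¹ (suc p) * (O (suc (n ℕ.+ p)) - O (suc (suc p)))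

closedForm : ℕ → ℕ → ℚ
closedForm n p = ι n * weight n p * odd (n ℕ.+ p) * odd⁻¹ p * harmonicPart n p

-- The quarter from the power of 2 meets the 2 from `central*binom`. The factor n+1 needs no
-- division, since both the summand and the closed form carry it.
weight-suc : ∀ n p → ι (suc n) * weight (suc n) p ≡ ½ * (odd (n ℕ.+ p) * weight n p)
weight-suc n p = begin
  N * (1/2^ (+ (2 ℕ.* suc n)) * x′)   ≡⟨ cong (λ h′ → N * (h′ * x′)) (1/2^-2*suc n) ⟩
  N * (½ * (½ * h) * x′)              ≡⟨ solve 3 (λ N h x′ → N :* (con ½ :* (con ½ :* h) :* x′) := con ½ :* (con ½ :* h) :* (N :* x′)) refl N h x′ ⟩
  ½ * (½ * h) * (N * x′)              ≡⟨ cong (½ * (½ * h) *_) (central*binom (suc n) (+ suc n) n p (binom-sucᵃ n p)) ⟩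
  ½ * (½ * h) * (ι 2 * (y * x))       ≡⟨ solve 3 (λ h y x → con ½ :* (con ½ :* h) :* (con (ι 2) :* (y :* x)) := con ½ :* (y :* (h :* x))) refl h y x ⟩
  ½ * (y * (h * x))                   ∎
  where
  open +-*-Solver
  N = ι (suc n)
  h = 1/2^ (+ (2 ℕ.* n))
  x = central (n ℕ.+ p) * binom (n ℕ.+ p) (+ n)
  x′ = central (suc (n ℕ.+ p)) * binom (suc (n ℕ.+ p)) (+ suc n)
  y = odd (n ℕ.+ p)

summand-suc : ∀ n p → summand p (suc n) ≡ ½ * (odd (n ℕ.+ p) * weight n p) * (O (suc (n ℕ.+ p)) - O p)
summand-suc n p = begin
  N * h * c * B * D       ≡⟨ solve 5 (λ N h c B D → N :* h :* c :* B :* D := N :* (h :* (c :* B)) :* D) refl N h c B D ⟩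
  N * (h * (c * B)) * D   ≡⟨ cong (_* D) (weight-suc n p) ⟩
  ½ * (odd (n ℕ.+ p) * weight n p) * D ∎
  where
  open +-*-Solver
  N = ι (suc n)
  h = 1/2^ (+ (2 ℕ.* suc n))
  c = central (suc n ℕ.+ p)
  B = binom (suc n ℕ.+ p) (+ suc n)
  D = O (suc (n ℕ.+ p)) - O p

-- The last summand, with y = 2 N + z, vanishes as soon as u, v, w are
-- the inverses of z, 2 + z and 2 + y.
telescoping-identity : ∀ N T z u v w a b → let y = ι 2 * N + z in
  ½ * (y * T) * (ι 2 * ι 1 + y) * u * ((a + w - (b + u)) - ι 2 * v * (a + w - (b + u + v)))
  ≡ (N * T * y * u * ((a - (b + u)) - ι 2 * v * (a - (b + u + v))) + ½ * (y * T) * (a - b))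
    + ½ * (y * T) * ((z * u - 1ℚ) * (a - b - u)
                    - ι 2 * ((ι 2 * ι 1 + z) * v - 1ℚ) * u * (a - b - u - v)
                    + ((ι 2 * ι 1 + y) * w - 1ℚ) * u * (1ℚ - ι 2 * v))
telescoping-identity = solve 8 (λ N T z u v w a b →
  let two = con (ι 2) ; 2+_ = λ x → two :* con (ι 1) :+ x ; y = two :* N :+ z ; yT = con ½ :* (y :* T) in
  yT :* (2+ y) :* u :* ((a :+ w :- (b :+ u)) :- two :* v :* (a :+ w :- (b :+ u :+ v)))
  := (N :* T :* y :* u :* ((a :- (b :+ u)) :- two :* v :* (a :- (b :+ u :+ v))) :+ yT :* (a :- b))
    :+ yT :* ((z :* u :- con 1ℚ) :* (a :- b :- u)
             :- two :* ((2+ z) :* v :- con 1ℚ) :* u :* (a :- b :- u :- v)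
             :+ ((2+ y) :* w :- con 1ℚ) :* u :* (con 1ℚ :- two :* v))) refl
  where open +-*-Solver

-- With the common factor `½ * y * T * u` taken out, `y - 2N = z` makes the coefficient of
-- `a - b - u` equal to (z+2)(1-2v) = z. The remaining constants 2v and 1-2v add up to 1 = zu, which
-- turns `a - b - u` back into `a - b`.
telescoping : ∀ N T z u v w a b → let y = ι 2 * N + z in
  z * u ≡ 1ℚ → (ι 2 * ι 1 + z) * v ≡ 1ℚ → (ι 2 * ι 1 + y) * w ≡ 1ℚ →
  ½ * (y * T) * (ι 2 * ι 1 + y) * u * ((a + w - (b + u)) - ι 2 * v * (a + w - (b + u + v)))
  ≡ N * T * y * u * ((a - (b + u)) - ι 2 * v * (a - (b + u + v))) + ½ * (y * T) * (a - b)
telescoping N T z u v w a b zu≡1 z′v≡1 y′w≡1 = begin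
  _                        ≡⟨ telescoping-identity N T z u v w a b ⟩
  -- The solver treats `u`, `v`, `w` as free variables; `error` exposes their three products with
  -- the inverted quantities, so that setting each to 1 removes the defect.
  L + error (z * u) ((ι 2 * ι 1 + z) * v) ((ι 2 * ι 1 + y) * w)
                           ≡⟨ cong (λ r → L + error r ((ι 2 * ι 1 + z) * v) ((ι 2 * ι 1 + y) * w)) zu≡1 ⟩
  L + error 1ℚ ((ι 2 * ι 1 + z) * v) ((ι 2 * ι 1 + y) * w)
                           ≡⟨ cong₂ (λ r s → L + error 1ℚ r s) z′v≡1 y′w≡1 ⟩
  L + error 1ℚ 1ℚ 1ℚ       ≡⟨ solve 6 (λ L c e u f g → let 0# = con 1ℚ :- con 1ℚ in
                                L :+ c :* (0# :* e :- con (ι 2) :* 0# :* u :* f :+ 0# :* u :* g) := L)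
                                refl L (½ * (y * T)) (a - b - u) u (a - b - u - v) (1ℚ - ι 2 * v) ⟩
  L                        ∎
  where
  open +-*-Solver
  y = ι 2 * N + z
  L = N * T * y * u * ((a - (b + u)) - ι 2 * v * (a - (b + u + v))) + ½ * (y * T) * (a - b)
  error : ℚ → ℚ → ℚ → ℚ
  error r s t = ½ * (y * T) * ((r - 1ℚ) * (a - b - u) - ι 2 * (s - 1ℚ) * u * (a - b - u - v)
                              + (t - 1ℚ) * u * (1ℚ - ι 2 * v))

closedForm-suc : ∀ n p → closedForm (suc n) p ≡ closedForm n p + summand p (suc n)
closedForm-suc n p = begin
  ι (suc n) * weight (suc n) p * odd (suc s) * u * H′
    ≡⟨ cong (λ x → x * odd (suc s) * u * H′) (weight-suc n p) ⟩
  ½ * (odd s * T) * odd (suc s) * u * H′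
    ≡⟨ cong (λ x → ½ * (odd s * T) * x * u * H′) (odd-+ 1 s) ⟩
  ½ * (odd s * T) * (ι 2 * ι 1 + odd s) * u * H′
    ≡⟨ cong (λ x → ½ * (x * T) * (ι 2 * ι 1 + x) * u * H′) (odd-+ n p) ⟩
  ½ * (y * T) * (ι 2 * ι 1 + y) * u * H′
    -- By the definition of `O`, with a = O_{s+1} and b = O_p, the other harmonic numbers unfold to
    -- O_{s+2} = a+w, O_{p+1} = b+u and O_{p+2} = b+u+v.
    ≡⟨ telescoping (ι n) T (odd p) u (odd⁻¹ (suc p)) (odd⁻¹ (suc s)) (O (suc s)) (O p) zu≡1 z′v≡1 y′w≡1 ⟩
  ι n * T * y * u * H + ½ * (y * T) * (O (suc s) - O p)
    ≡⟨ cong (λ x → ι n * T * x * u * H + ½ * (x * T) * (O (suc s) - O p)) (odd-+ n p) ⟨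
  closedForm n p + ½ * (odd s * T) * (O (suc s) - O p)
    ≡⟨ cong (λ x → closedForm n p + x) (summand-suc n p) ⟨
  closedForm n p + summand p (suc n) ∎
  where
  s = n ℕ.+ p
  T = weight n p
  u = odd⁻¹ p
  y = ι 2 * ι n + odd p
  H = harmonicPart n p
  H′ = harmonicPart (suc n) p
  zu≡1 : odd p * u ≡ 1ℚ
  zu≡1 = n*1/n≡1 (suc (2 ℕ.* p))
  z′v≡1 : (ι 2 * ι 1 + odd p) * odd⁻¹ (suc p) ≡ 1ℚ
  z′v≡1 = trans (cong (_* odd⁻¹ (suc p)) (sym (odd-+ 1 p))) (n*1/n≡1 (suc (2 ℕ.* suc p)))
  y′w≡1 : (ι 2 * ι 1 + y) * odd⁻¹ (suc s) ≡ 1ℚ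
  y′w≡1 = trans
    (cong (_* odd⁻¹ (suc s)) (sym (trans (odd-+ 1 s) (cong (λ x → ι 2 * ι 1 + x) (odd-+ n p)))))
    (n*1/n≡1 (suc (2 ℕ.* suc s)))

-- Summation and the general formula.

∑₁-cong : ∀ n {f g : ℕ → ℚ} → (∀ k → f k ≡ g k) → ∑₁ n f ≡ ∑₁ n g
∑₁-cong zero    f≗g = refl
∑₁-cong (suc n) f≗g = cong₂ _+_ (∑₁-cong n f≗g) (f≗g (suc n))

∑-summand : ∀ n p → ∑₁ n (summand p) ≡ closedForm n p
∑-summand zero    p = sym (solve 4 (λ T y u H → con 0ℚ :* T :* y :* u :* H := con 0ℚ) refl
                        (weight 0 p) (odd p) (odd⁻¹ p) (harmonicPart 0 p))
  where open +-*-Solver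
∑-summand (suc n) p = trans (cong (_+ summand p (suc n)) (∑-summand n p)) (sym (closedForm-suc n p))

-- The right-hand side of the theorem, with a = n + p + 1, b = p + 1, c = p + 2.
rhs : ℕ → ℕ → ℕ → ℕ → ℕ → ℚ
rhs n p a b c =
  ι n * 1/2^ (+ (2 ℕ.* n)) * centralBinom⁻¹ b * central p * central a * binom a (+ n) * (O a - O b)
  - 1/2^ (+ (2 ℕ.* n) ℤ.- + 2) * centralBinom⁻¹ c * central p * central a * binom a (+ n ℤ.- + 1) * (O a - O c)

-- The product (2s+1)T(n) supplies the binomials of index s+1 together with a factor p+1. This
-- factor and the odd reciprocals then assemble into the inverse central binomials.
closedForm≡rhs : ∀ n p → closedForm n p ≡ rhs n p (suc (n ℕ.+ p)) (suc p) (suc (suc p))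
closedForm≡rhs n p = begin
  N * (h * x) * y * u * (X - ι 2 * v * Y)
    ≡⟨ solve 8 (λ N h x y u X v Y → N :* (h :* x) :* y :* u :* (X :- con (ι 2) :* v :* Y)
         := con ½ :* N :* h :* u :* X :* (con (ι 2) :* (y :* x)) :- h :* u :* v :* N :* Y :* (con (ι 2) :* (y :* x)))
         refl N h x y u X v Y ⟩
  ½ * N * h * u * X * (ι 2 * (y * x)) - h * u * v * N * Y * (ι 2 * (y * x))
    ≡⟨ cong (λ r → ½ * N * h * u * X * r - h * u * v * N * Y * r) (central*binom (suc p) (+ n) n p (binom-sucᵇ n p)) ⟨
  ½ * N * h * u * X * (P * (c′ * B₁)) - h * u * v * N * Y * (P * (c′ * B₁))
    ≡⟨ cong₂ _-_
         (solve 7 (λ N h u X P c′ B₁ → con ½ :* N :* h :* u :* X :* (P :* (c′ :* B₁)) := N :* h :* (con ½ :* (P :* u)) :* c′ :* B₁ :* X) refl N h u X P c′ B₁)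
         (solve 8 (λ h u v N Y P c′ B₁ → h :* u :* v :* N :* Y :* (P :* (c′ :* B₁)) := h :* u :* v :* Y :* P :* c′ :* (N :* B₁)) refl h u v N Y P c′ B₁) ⟩
  N * h * (½ * (P * u)) * c′ * B₁ * X - h * u * v * Y * P * c′ * (N * B₁)
    ≡⟨ cong₂ (λ r s → N * h * r * c′ * B₁ * X - h * u * v * Y * P * c′ * s) (centralBinom⁻¹[1+p]*central p) (binom-pred n p) ⟨
  N * h * (i₁ * c) * c′ * B₁ * X - h * u * v * Y * P * c′ * (Q * B₂)
    ≡⟨ cong₂ _-_
         (solve 7 (λ N h i₁ c c′ B₁ X → N :* h :* (i₁ :* c) :* c′ :* B₁ :* X := N :* h :* i₁ :* c :* c′ :* B₁ :* X) refl N h i₁ c c′ B₁ X)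
         -- The inserted constants multiply to 1: the 4 belongs to the power with exponent 2n-2, the
         -- two halves to the inverse central binomial of index p+2.
         (solve 8 (λ h u v Y P c′ Q B₂ → h :* u :* v :* Y :* P :* c′ :* (Q :* B₂)
           := con (ι 4) :* h :* (con ½ :* (Q :* v) :* (con ½ :* (P :* u))) :* c′ :* B₂ :* Y) refl h u v Y P c′ Q B₂) ⟩
  N * h * i₁ * c * c′ * B₁ * X - ι 4 * h * (½ * (Q * v) * (½ * (P * u))) * c′ * B₂ * Y
    ≡⟨ cong₂ (λ r s → N * h * i₁ * c * c′ * B₁ * X - r * s * c′ * B₂ * Y) (1/2^[2n-2] n) (centralBinom⁻¹[2+p]*central p) ⟨
  N * h * i₁ * c * c′ * B₁ * X - g * (i₂ * c) * c′ * B₂ * Y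
    ≡⟨ cong (λ r → N * h * i₁ * c * c′ * B₁ * X - r * c′ * B₂ * Y) (*-assoc g i₂ c) ⟨
  N * h * i₁ * c * c′ * B₁ * X - g * i₂ * c * c′ * B₂ * Y ∎
  where
  open +-*-Solver
  s = n ℕ.+ p
  N = ι n
  h = 1/2^ (+ (2 ℕ.* n))
  g = 1/2^ (+ (2 ℕ.* n) ℤ.- + 2)
  x = central s * binom s (+ n)
  y = odd s
  u = odd⁻¹ p
  v = odd⁻¹ (suc p)
  X = O (suc s) - O (suc p)
  Y = O (suc s) - O (suc (suc p))
  P = ι (suc p)
  Q = ι (suc (suc p))
  c = central p
  c′ = central (suc s)
  B₁ = binom (suc s) (+ n)
  B₂ = binom (suc s) (+ n ℤ.- + 1)
  i₁ = centralBinom⁻¹ (suc p)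
  i₂ = centralBinom⁻¹ (suc (suc p))

∑-summand≡rhs : ∀ n p → ∑₁ n (summand p) ≡ rhs n p (n ℕ.+ p ℕ.+ 1) (p ℕ.+ 1) (p ℕ.+ 2)
∑-summand≡rhs n p = begin
  ∑₁ n (summand p)                                    ≡⟨ ∑-summand n p ⟩
  closedForm n p                                      ≡⟨ closedForm≡rhs n p ⟩
  rhs n p (suc (n ℕ.+ p)) (suc p) (suc (suc p))       ≡⟨ cong (λ a → rhs n p a (suc p) (suc (suc p))) (ℕ.+-comm 1 (n ℕ.+ p)) ⟩
  rhs n p (n ℕ.+ p ℕ.+ 1) (suc p) (suc (suc p))       ≡⟨ cong₂ (rhs n p (n ℕ.+ p ℕ.+ 1)) (ℕ.+-comm 1 p) (ℕ.+-comm 2 p) ⟩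
  rhs n p (n ℕ.+ p ℕ.+ 1) (p ℕ.+ 1) (p ℕ.+ 2)         ∎

-- The special case p = 0.

summand-0 : ∀ k → summand 0 k ≡ ι k * 1/2^ (+ (2 ℕ.* k)) * central k * O k
summand-0 k = begin
  summand 0 k                             ≡⟨ cong (λ m → x * central m * binom m (+ k) * (O m - O 0)) (ℕ.+-identityʳ k) ⟩
  x * central k * ι (k C k) * (O k - 0ℚ)  ≡⟨ cong (λ m → x * central k * ι m * (O k - 0ℚ)) (nCn≡1 k) ⟩
  x * central k * 1ℚ * (O k - 0ℚ)         ≡⟨ solve 3 (λ x c o → x :* c :* con 1ℚ :* (o :- con 0ℚ) := x :* c :* o) refl x (central k) (O k) ⟩
  x * central k * O k                     ∎
  where
  open +-*-Solver
  x = ι k * 1/2^ (+ (2 ℕ.* k))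

binom[1+n,n] : ∀ n → binom (suc n) (+ n) ≡ ι (suc n)
binom[1+n,n] n = begin
  B                           ≡⟨ solve 1 (λ B → B := con (ι 1) :* B) refl B ⟩
  ι 1 * B                     ≡⟨ subst (λ s → ι 1 * binom (suc s) (+ n) ≡ ι (suc s) * binom s (+ n)) (ℕ.+-identityʳ n) (binom-sucᵇ n 0) ⟩
  ι (suc n) * ι (n C n)       ≡⟨ cong (λ m → ι (suc n) * ι m) (nCn≡1 n) ⟩
  ι (suc n) * 1ℚ              ≡⟨ *-identityʳ _ ⟩
  ι (suc n)                   ∎
  where
  open +-*-Solver
  B = binom (suc n) (+ n)

-- This is `binom-pred` at p = 0, so the lower index -1 at n = 0 is covered as well.
binom[1+n,n-1] : ∀ n → binom (suc n) (+ n ℤ.- + 1) ≡ ½ * (ι n * ι (suc n))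
binom[1+n,n-1] n = begin
  B                           ≡⟨ solve 1 (λ B → B := con ½ :* (con (ι 2) :* B)) refl B ⟩
  ½ * (ι 2 * B)               ≡⟨ cong (½ *_) (subst (λ s → ι 2 * binom (suc s) (+ n ℤ.- + 1) ≡ ι n * binom (suc s) (+ n)) (ℕ.+-identityʳ n) (binom-pred n 0)) ⟩
  ½ * (ι n * binom (suc n) (+ n)) ≡⟨ cong (λ b → ½ * (ι n * b)) (binom[1+n,n] n) ⟩
  ½ * (ι n * ι (suc n))       ∎
  where
  open +-*-Solver
  B = binom (suc n) (+ n ℤ.- + 1)

-- Here `m` stands for n+1 and `e` for 2n+1, kept as parameters so that `suc n` can be exchanged for
-- `n + 1` by congruence.
rhs₀ : ℕ → ℕ → ℕ → ℚ
rhs₀ n m e = (+ (n ℕ.* m) / 1) * 1/2^ (+ e) * central m * (O m - 1ℚ)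
  - (+ (n ℕ.* m) / 3) * 1/2^ (+ (2 ℕ.* n)) * central m * (O m - + 4 / 3)

rhs≡rhs₀ : ∀ n → rhs n 0 (suc n) 1 2 ≡ rhs₀ n (suc n) (suc (2 ℕ.* n))
rhs≡rhs₀ n = begin
  -- Evaluation at p = 0 gives 1/C(2,1) = 1/2, 1/C(4,2) = 1/6, C(0,0) = 1, O_1 = 1 and O_2 = 4/3.
  N * h * ½ * 1ℚ * c * B₁ * (o - 1ℚ) - 1/2^ (+ (2 ℕ.* n) ℤ.- + 2) * ⅙ * 1ℚ * c * B₂ * (o - + 4 / 3)
    ≡⟨ cong₂ (λ r s → N * h * ½ * 1ℚ * c * B₁ * (o - 1ℚ) - r * ⅙ * 1ℚ * c * s * (o - + 4 / 3)) (1/2^[2n-2] n) (binom[1+n,n-1] n) ⟩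
  N * h * ½ * 1ℚ * c * B₁ * (o - 1ℚ) - ι 4 * h * ⅙ * 1ℚ * c * (½ * (N * M)) * (o - + 4 / 3)
    ≡⟨ cong (λ r → N * h * ½ * 1ℚ * c * r * (o - 1ℚ) - ι 4 * h * ⅙ * 1ℚ * c * (½ * (N * M)) * (o - + 4 / 3)) (binom[1+n,n] n) ⟩
  N * h * ½ * 1ℚ * c * M * (o - 1ℚ) - ι 4 * h * ⅙ * 1ℚ * c * (½ * (N * M)) * (o - + 4 / 3)
    ≡⟨ solve 5 (λ N h c M o →
         N :* h :* con ½ :* con 1ℚ :* c :* M :* (o :- con 1ℚ) :- con (ι 4) :* h :* con ⅙ :* con 1ℚ :* c :* (con ½ :* (N :* M)) :* (o :- con (+ 4 / 3))
         := (N :* M) :* (con ½ :* h) :* c :* (o :- con 1ℚ) :- (N :* M) :* con (+ 1 / 3) :* h :* c :* (o :- con (+ 4 / 3))) refl N h c M o ⟩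
  (N * M) * (½ * h) * c * (o - 1ℚ) - (N * M) * (+ 1 / 3) * h * c * (o - + 4 / 3)
    ≡⟨ cong₂ (λ r s → r * s * c * (o - 1ℚ) - r * (+ 1 / 3) * h * c * (o - + 4 / 3)) (ι-homo-* n (suc n)) (1/2^-suc (2 ℕ.* n)) ⟨
  ι (n ℕ.* suc n) * 1/2^ (+ suc (2 ℕ.* n)) * c * (o - 1ℚ) - ι (n ℕ.* suc n) * (+ 1 / 3) * h * c * (o - + 4 / 3)
    ≡⟨ cong (λ r → ι (n ℕ.* suc n) * 1/2^ (+ suc (2 ℕ.* n)) * c * (o - 1ℚ) - r * h * c * (o - + 4 / 3)) (n/d≡n*1/d (n ℕ.* suc n) 3) ⟨
  rhs₀ n (suc n) (suc (2 ℕ.* n)) ∎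
  where
  open +-*-Solver
  ⅙ = + 1 / 6
  N = ι n
  M = ι (suc n)
  h = 1/2^ (+ (2 ℕ.* n))
  c = central (suc n)
  o = O (suc n)
  B₁ = binom (suc n) (+ n)
  B₂ = binom (suc n) (+ n ℤ.- + 1)

∑-summand₀ : ∀ n → ∑₁ n (λ k → ι k * 1/2^ (+ (2 ℕ.* k)) * central k * O k) ≡ rhs₀ n (n ℕ.+ 1) (2 ℕ.* n ℕ.+ 1)
∑-summand₀ n = begin
  ∑₁ n (λ k → ι k * 1/2^ (+ (2 ℕ.* k)) * central k * O k)   ≡⟨ ∑₁-cong n summand-0 ⟨
  ∑₁ n (summand 0)                     ≡⟨ trans (∑-summand n 0) (closedForm≡rhs n 0) ⟩
  rhs n 0 (suc (n ℕ.+ 0)) 1 2          ≡⟨ cong (λ m → rhs n 0 (suc m) 1 2) (ℕ.+-identityʳ n) ⟩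
  rhs n 0 (suc n) 1 2                  ≡⟨ rhs≡rhs₀ n ⟩
  rhs₀ n (suc n) (suc (2 ℕ.* n))       ≡⟨ cong₂ (rhs₀ n) (ℕ.+-comm 1 n) (ℕ.+-comm 1 (2 ℕ.* n)) ⟩
  rhs₀ n (n ℕ.+ 1) (2 ℕ.* n ℕ.+ 1)     ∎

theorem15 :
    ((n p : ℕ) →
      ∑₁ n (λ k →
        (+ k / 1) * 1/2^ (+ (2 ℕ.* k))
          * binom (2 ℕ.* (k ℕ.+ p)) (+ (k ℕ.+ p))
          * binom (k ℕ.+ p) (+ k)
          * (O (k ℕ.+ p) - O p))
      ≡
      (+ n / 1) * 1/2^ (+ (2 ℕ.* n))
        * centralBinom⁻¹ (p ℕ.+ 1)
        * binom (2 ℕ.* p) (+ p)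
        * binom (2 ℕ.* (n ℕ.+ p ℕ.+ 1)) (+ (n ℕ.+ p ℕ.+ 1))
        * binom (n ℕ.+ p ℕ.+ 1) (+ n)
        * (O (n ℕ.+ p ℕ.+ 1) - O (p ℕ.+ 1))
      - 1/2^ (+ (2 ℕ.* n) ℤ.- + 2)
        * centralBinom⁻¹ (p ℕ.+ 2)
        * binom (2 ℕ.* p) (+ p)
        * binom (2 ℕ.* (n ℕ.+ p ℕ.+ 1)) (+ (n ℕ.+ p ℕ.+ 1))
        * binom (n ℕ.+ p ℕ.+ 1) (+ n ℤ.- + 1)
        * (O (n ℕ.+ p ℕ.+ 1) - O (p ℕ.+ 2)))
    ×
    ((n : ℕ) →
      ∑₁ n (λ k →
        (+ k / 1) * 1/2^ (+ (2 ℕ.* k)) * binom (2 ℕ.* k) (+ k) * O k)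
      ≡
      (+ (n ℕ.* (n ℕ.+ 1)) / 1) * 1/2^ (+ (2 ℕ.* n ℕ.+ 1))
        * binom (2 ℕ.* (n ℕ.+ 1)) (+ (n ℕ.+ 1))
        * (O (n ℕ.+ 1) - 1ℚ)
      - (+ (n ℕ.* (n ℕ.+ 1)) / 3) * 1/2^ (+ (2 ℕ.* n))
        * binom (2 ℕ.* (n ℕ.+ 1)) (+ (n ℕ.+ 1))
        * (O (n ℕ.+ 1) - + 4 / 3))
theorem15 = ∑-summand≡rhs , ∑-summand₀
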